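{- In the $2$-pass streaming model with a single output pass, Sliding-Min can be solved in $O\big(\sqrt N\,(\log R+\log N)\big)$ bits of space, where $N$ is the length of the input and $R$ is the upper bound on its values (the bound holds for every window size $K$, with an absolute implied constant).
   Context: Problem. The input is an array $A_0,\dots,A_{N-1}$ of integers in $[0,R]$ together with a window size $K\le N$. Sliding-Min asks for the minimum of $A_i,\dots,A_{i+K-1}$ for every $i\in\{0,\dots,N-K\}$. $p$-pass streaming model (here $p=2$). The algorithm knows $N,K,R$ in advance. The input is accessed only through $p$ sequential left-to-right scans (input passes). The $N-K+1$ answers are written to a write-only output stream, each exactly once. A single output pass means that, over the whole execution, the answers are written in the order of increasing window index $i=0,1,\dots,N-K$. Output need not be synchronized with the input position: at any time the algorithm may write any number of answers. Space is the maximum number of bits of working memory held at any time; input and output streams are not counted. -}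

module Defs where

open import Data.Bool using (Bool)
open import Data.Fin using (Fin; toℕ)
import Data.Fin as Fin
open import Data.List using (List; []; _∷_; length; concat; replicate)
open import Data.Nat using (ℕ; suc; _+_; _*_; _∸_; _⊔_; _≤_; _<_)
open import Data.Product using (_×_; ∃-syntax)
open import Data.Vec using (Vec; lookup; toList)
open import Relation.Binary.PropositionalEquality using (_≡_)

-- The integers in [0,R].
Value : ℕ → Set
Value R = Fin (suc R)

InWindow : ∀ {N} → ℕ → ℕ → Fin N → Set
InWindow K i t = i ≤ toℕ t × toℕ t < i + K

IsWindowMin : ∀ {R N} → Vec (Value R) N → ℕ → ℕ → Value R → Set
IsWindowMin A K i v =
  (∃[ t ] InWindow K i t × lookup A t ≡ v) ×
  (∀ t → InWindow K i t → v Fin.≤ lookup A t)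

-- For 1 ≤ K ≤ N there are N ∸ K + 1 windows; the answer to the i-th one
-- must be the i-th value of the output.
IsSlidingMin : ∀ {R N} (K : ℕ) → Vec (Value R) N →
               Vec (Value R) (suc (N ∸ K)) → Set
IsSlidingMin K A out = ∀ i → IsWindowMin A K (toℕ i) (lookup out i)

-- The entire working memory of a machine.  Everything that persists from one
-- step to the next (program counter, position in the input, pass number, …)
-- has to be stored here.
Memory : Set
Memory = List Bool

data Action (R : ℕ) : Set where
  read  : (Value R → Memory) → Action R
  write : Value R → Memory → Action R
  halt  : Action R

-- Transitions are arbitrary functions, as usual when only space is measured.
record Machine (R : ℕ) : Set where
  field
    init : Memory
    step : Memory → Action R

-- Scanning the input p times from left to right amounts to reading p
-- consecutive copies of it once.  The machine gets no signal at the end of a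
-- scan; it knows N and may count.
passes : ∀ {R N} → ℕ → Vec (Value R) N → List (Value R)
passes p A = concat (replicate p (toList A))

-- Run M m xs out: started with memory m and unread input xs, the machine M
-- halts after having written exactly out, from left to right.  A machine
-- that reads past the end of xs has no run.
data Run {R : ℕ} (M : Machine R) :
         Memory → List (Value R) → List (Value R) → Set where
  halted : ∀ {m xs} → Machine.step M m ≡ halt → Run M m xs []
  reads  : ∀ {m f x xs out} → Machine.step M m ≡ read f →
           Run M (f x) xs out → Run M m (x ∷ xs) out
  writes : ∀ {m v m′ xs out} → Machine.step M m ≡ write v m′ →
           Run M m′ xs out → Run M m xs (v ∷ out)

Execution : ∀ {R} → Machine R → List (Value R) → List (Value R) → Set
Execution M = Run M (Machine.init M)

space : ∀ {R} {M : Machine R} {m xs out} → Run M m xs out → ℕ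
space {m = m} (halted _)   = length m
space {m = m} (reads _ r)  = length m ⊔ space r
space {m = m} (writes _ r) = length m ⊔ space r

-- The algorithm knows N, K and R (in this order) in advance.
Algorithm : Set
Algorithm = (N K R : ℕ) → Machine R

-- s ≤ a ·√ n  is the real inequality s ≤ a √n, squared.
infix 4 _≤_·√_
_≤_·√_ : ℕ → ℕ → ℕ → Set
s ≤ a ·√ n = s * s ≤ a * a * n

{-# OPTIONS --safe #-}
module Submission where

-- Cut the input into blocks of length at most √N in such a way that the shift by
-- K maps blocks to blocks: q(i + K) = q(i) + L for the index q of the block of a
-- position.  A window then consists of a tail of block Q, the whole blocks
-- strictly between Q and Q + L, and a head of block Q + L.  If K ≤ √N, then
-- L = 1 and there are no blocks in between; otherwise there are O(√N) blocks, and
-- the first pass computes the minima of all of them.  Knowing them, call the tail of Q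
-- relevant if min Q is smaller than all minima strictly between Q and Q + L,
-- and the head relevant if min (Q + L) is.  The second pass writes each answer
-- as soon as the tail has been read and, if the head is relevant, the whole
-- window has been read.  While the answer for a window starting in Q waits for
-- its head, no block Q′ strictly between Q and Q + L has a relevant tail: the
-- relevant head of Q says min (Q + L) < min Q′, and Q + L lies strictly between
-- Q′ and Q′ + L.  So it suffices to store the current block and the last earlier
-- block with a relevant tail.

open import Data.Bool using (Bool; true; false)
open import Data.Fin using (Fin; toℕ; fromℕ<) renaming (zero to fzero; suc to fsuc)
open import Data.Fin.Properties using (toℕ-fromℕ<; toℕ-injective; toℕ<n)
open import Data.List using (List; []; _∷_; _++_; length; map; foldr; filter; take; drop; upTo; replicate)
open import Data.List.Properties using (filter-reject; length-++; length-replicate; drop-all)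
open import Data.List.Membership.Propositional using (_∈_)
open import Data.List.Membership.Propositional.Properties
  using (∈-map⁺; ∈-map⁻; ∈-++⁺ˡ; ∈-++⁺ʳ; ∈-++⁻; ∈-filter⁺; ∈-filter⁻; ∈-upTo⁺; ∈-upTo⁻; foldr-selective)
open import Data.List.Relation.Unary.All as All using (All; []; _∷_)
import Data.List.Relation.Unary.All.Properties as All
open import Data.List.Relation.Unary.Any using (here; there)
open import Data.Nat
open import Data.Nat.Binary.Base using (ℕᵇ; 2[1+_]; 1+[2_]; fromℕ) renaming (toℕ to ⟦_⟧; size to ∣_∣ᵇ)
open import Data.Nat.Binary.Properties using (toℕ-fromℕ)
open import Data.Nat.DivMod
open import Data.Nat.Logarithm using (⌈log₂_⌉; ⌈log₂⌉-mono-≤; ⌈log₂2^n⌉≡n)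
open import Data.Nat.Properties
open import Data.Nat.Solver using (module +-*-Solver)
open import Data.Product using (Σ; Σ-syntax; _×_; _,_; proj₁; proj₂; ∃-syntax)
open import Data.Sum as Sum using (_⊎_; inj₁; inj₂)
open import Data.Vec using (Vec; []; _∷_; toList; lookup)
open import Data.Vec.Properties using (length-toList)
open import Function using (_∘_)
open import Relation.Binary.Definitions using (tri<; tri≈; tri>)
open import Relation.Binary.PropositionalEquality
open import Relation.Nullary using (Dec; yes; no; ¬_; contradiction)
open import Relation.Nullary.Decidable using (_×-dec_; _⊎-dec_; _→-dec_; ¬?)
open import Relation.Unary using (Decidable)
open import Defs

-- Encoding of lists of numbers as bit strings.

-- A prefix-free code: every binary digit is announced by true, the end of a
-- number by false.
put : ℕᵇ → List Bool → List Bool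
put ℕᵇ.zero   rest = false ∷ rest
put 2[1+ x ]  rest = true ∷ true ∷ put x rest
put 1+[2 x ]  rest = true ∷ false ∷ put x rest

digit : Bool → List ℕᵇ → List ℕᵇ
digit _     []       = []
digit true  (x ∷ xs) = 2[1+ x ] ∷ xs
digit false (x ∷ xs) = 1+[2 x ] ∷ xs

parse : List Bool → List ℕᵇ
parse []                = []
parse (false ∷ rest)    = ℕᵇ.zero ∷ parse rest
parse (true ∷ [])       = []
parse (true ∷ d ∷ rest) = digit d (parse rest)

encode : List ℕ → List Bool
encode = foldr (put ∘ fromℕ) []

decode : List Bool → List ℕ
decode = map ⟦_⟧ ∘ parse

parse-put : ∀ x rest → parse (put x rest) ≡ x ∷ parse rest
parse-put ℕᵇ.zero  rest = refl
parse-put 2[1+ x ] rest = cong (digit true) (parse-put x rest)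
parse-put 1+[2 x ] rest = cong (digit false) (parse-put x rest)

decode-encode : ∀ ns → decode (encode ns) ≡ ns
decode-encode []       = refl
decode-encode (n ∷ ns) =
  trans (cong (map ⟦_⟧) (parse-put (fromℕ n) (encode ns)))
        (cong₂ _∷_ (toℕ-fromℕ n) (decode-encode ns))

length-put : ∀ x rest → length (put x rest) ≡ 1 + 2 * ∣ x ∣ᵇ + length rest
length-put ℕᵇ.zero  rest = refl
length-put 2[1+ x ] rest = trans (cong (2 +_) (length-put x rest))
  (solve 2 (λ s r → con 2 :+ (con 1 :+ con 2 :* s :+ r) :=
                    con 1 :+ con 2 :* (con 1 :+ s) :+ r) refl ∣ x ∣ᵇ (length rest))
  where open +-*-Solver
length-put 1+[2 x ] rest = trans (cong (2 +_) (length-put x rest))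
  (solve 2 (λ s r → con 2 :+ (con 1 :+ con 2 :* s :+ r) :=
                    con 1 :+ con 2 :* (con 1 :+ s) :+ r) refl ∣ x ∣ᵇ (length rest))
  where open +-*-Solver

-- `ℕᵇ` is bijective binary, with digits 1 and 2, so the least number with s digits is 1...1 = 2^s -
-- 1.
2^size≤1+toℕ : ∀ x → 2 ^ ∣ x ∣ᵇ ≤ suc ⟦ x ⟧
2^size≤1+toℕ ℕᵇ.zero  = ≤-refl
2^size≤1+toℕ 2[1+ x ] = m≤n⇒m≤1+n (*-monoʳ-≤ 2 (2^size≤1+toℕ x))
2^size≤1+toℕ 1+[2 x ] = ≤-trans (*-monoʳ-≤ 2 (2^size≤1+toℕ x)) (≤-reflexive (*-suc 2 ⟦ x ⟧))

size-fromℕ : ∀ n → ∣ fromℕ n ∣ᵇ ≤ ⌈log₂ suc n ⌉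
size-fromℕ n = begin
  ∣ fromℕ n ∣ᵇ                 ≡⟨ ⌈log₂2^n⌉≡n ∣ fromℕ n ∣ᵇ ⟨
  ⌈log₂ 2 ^ ∣ fromℕ n ∣ᵇ ⌉     ≤⟨ ⌈log₂⌉-mono-≤ (2^size≤1+toℕ (fromℕ n)) ⟩
  ⌈log₂ suc ⟦ fromℕ n ⟧ ⌉      ≡⟨ cong (λ m → ⌈log₂ suc m ⌉) (toℕ-fromℕ n) ⟩
  ⌈log₂ suc n ⌉                ∎
  where open ≤-Reasoning

length-encode : ∀ {ℓ} ns → All (λ n → ⌈log₂ suc n ⌉ ≤ ℓ) ns →
                length (encode ns) ≤ length ns * (1 + 2 * ℓ)
length-encode []       []             = z≤n
length-encode {ℓ} (n ∷ ns) (log≤ℓ ∷ rest) = begin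
  length (put (fromℕ n) (encode ns))                ≡⟨ length-put (fromℕ n) (encode ns) ⟩
  1 + 2 * ∣ fromℕ n ∣ᵇ + length (encode ns)          ≤⟨ +-mono-≤
                                                         (+-monoʳ-≤ 1 (*-monoʳ-≤ 2 (≤-trans (size-fromℕ n) log≤ℓ)))
                                                         (length-encode ns rest) ⟩
  1 + 2 * ℓ + length ns * (1 + 2 * ℓ)                ∎
  where open ≤-Reasoning

-- Pairs, prefixes and filters of lists.

flatten : List (ℕ × ℕ) → List ℕ
flatten []             = []
flatten ((m , n) ∷ xs) = m ∷ n ∷ flatten xs

pairUp : List ℕ → List (ℕ × ℕ)
pairUp (m ∷ n ∷ ns) = (m , n) ∷ pairUp ns
pairUp _            = []

pairUp-flatten : ∀ xs → pairUp (flatten xs) ≡ xs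
pairUp-flatten []       = refl
pairUp-flatten (x ∷ xs) = cong (x ∷_) (pairUp-flatten xs)

All-flatten : ∀ {P : ℕ → Set} {xs} → All (λ (m , n) → P m × P n) xs → All P (flatten xs)
All-flatten []               = []
All-flatten ((pm , pn) ∷ ps) = pm ∷ pn ∷ All-flatten ps

length-flatten : ∀ xs → length (flatten xs) ≡ length xs * 2
length-flatten []       = refl
length-flatten (_ ∷ xs) = cong (2 +_) (length-flatten xs)

take-length : ∀ {A : Set} (xs ys : List A) → take (length xs) (xs ++ ys) ≡ xs
take-length []       ys = refl
take-length (x ∷ xs) ys = cong (x ∷_) (take-length xs ys)

drop-length : ∀ {A : Set} (xs ys : List A) → drop (length xs) (xs ++ ys) ≡ ys
drop-length []       ys = refl
drop-length (_ ∷ xs) ys = drop-length xs ys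

length-filter-split :
  ∀ {A : Set} {P Q S : A → Set} (P? : Decidable P) (Q? : Decidable Q) (S? : Decidable S) →
  (∀ {x} → P x → Q x ⊎ S x) → ∀ xs →
  length (filter P? xs) ≤ length (filter Q? xs) + length (filter S? xs)
length-filter-split P? Q? S? split [] = z≤n
length-filter-split P? Q? S? split (x ∷ xs)
  with P? x | Q? x | S? x | length-filter-split P? Q? S? split xs
... | no _  | no _  | no _  | ih = ih
... | no _  | no _  | yes _ | ih = ≤-trans ih (+-monoʳ-≤ _ (n≤1+n _))
... | no _  | yes _ | no _  | ih = m≤n⇒m≤1+n ih
... | no _  | yes _ | yes _ | ih = m≤n⇒m≤1+n (≤-trans ih (+-monoʳ-≤ _ (n≤1+n _)))
... | yes _ | yes _ | no _  | ih = s≤s ih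
... | yes _ | yes _ | yes _ | ih = s≤s (≤-trans ih (+-monoʳ-≤ _ (n≤1+n _)))
... | yes _ | no _  | yes _ | ih = ≤-trans (s≤s ih) (≤-reflexive (sym (+-suc _ _)))
... | yes p | no ¬q | no ¬s | ih with split p
...   | inj₁ q = contradiction q ¬q
...   | inj₂ s = contradiction s ¬s

-- It lets a list that is pruned step by step be described as one filtering of everything read.
filter-filter :
  ∀ {A : Set} {P Q : A → Set} (P? : Decidable P) (Q? : Decidable Q) →
  (∀ {x} → P x → Q x) → ∀ xs → filter P? (filter Q? xs) ≡ filter P? xs
filter-∷-filter :
  ∀ {A : Set} {P Q : A → Set} (P? : Decidable P) (Q? : Decidable Q) →
  (∀ {x} → P x → Q x) → ∀ x xs → filter P? (x ∷ filter Q? xs) ≡ filter P? (x ∷ xs)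

filter-filter P? Q? P⇒Q [] = refl
filter-filter P? Q? P⇒Q (x ∷ xs) with Q? x
... | yes _ = filter-∷-filter P? Q? P⇒Q x xs
... | no ¬q = trans (filter-filter P? Q? P⇒Q xs) (sym (filter-reject P? (¬q ∘ P⇒Q)))

filter-∷-filter P? Q? P⇒Q x xs with P? x
... | yes _ = cong (x ∷_) (filter-filter P? Q? P⇒Q xs)
... | no _  = filter-filter P? Q? P⇒Q xs

-- Lists as arrays of running minima.

nth : ℕ → List ℕ → ℕ → ℕ
nth d []       _       = d
nth d (x ∷ xs) zero    = x
nth d (x ∷ xs) (suc i) = nth d xs i

lower : ℕ → ℕ → List ℕ → List ℕ
lower x _       []       = []
lower x zero    (y ∷ ys) = (x ⊓ y) ∷ ys
lower x (suc i) (y ∷ ys) = y ∷ lower x i ys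

length-lower : ∀ x i ys → length (lower x i ys) ≡ length ys
length-lower x _       []       = refl
length-lower x zero    (y ∷ ys) = refl
length-lower x (suc i) (y ∷ ys) = cong suc (length-lower x i ys)

nth-lower-≤ : ∀ d x i ys j → nth d (lower x i ys) j ≤ nth d ys j
nth-lower-≤ d x _       []       j       = ≤-refl
nth-lower-≤ d x zero    (y ∷ ys) zero    = m⊓n≤n x y
nth-lower-≤ d x zero    (y ∷ ys) (suc j) = ≤-refl
nth-lower-≤ d x (suc i) (y ∷ ys) zero    = ≤-refl
nth-lower-≤ d x (suc i) (y ∷ ys) (suc j) = nth-lower-≤ d x i ys j

nth-lower-≤-new : ∀ d x i ys → i < length ys → nth d (lower x i ys) i ≤ x
nth-lower-≤-new d x zero    (y ∷ ys) _         = m⊓n≤m x y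
nth-lower-≤-new d x (suc i) (y ∷ ys) (s≤s i<n) = nth-lower-≤-new d x i ys i<n

nth-lower-sel : ∀ d x i ys j →
  nth d (lower x i ys) j ≡ nth d ys j ⊎ (i ≡ j × x ≡ nth d (lower x i ys) j)
nth-lower-sel d x _       []       j       = inj₁ refl
nth-lower-sel d x zero    (y ∷ ys) zero    with ⊓-sel x y
... | inj₁ eq = inj₂ (refl , sym eq)
... | inj₂ eq = inj₁ eq
nth-lower-sel d x zero    (y ∷ ys) (suc j) = inj₁ refl
nth-lower-sel d x (suc i) (y ∷ ys) zero    = inj₁ refl
nth-lower-sel d x (suc i) (y ∷ ys) (suc j) with nth-lower-sel d x i ys j
... | inj₁ eq         = inj₁ eq
... | inj₂ (i≡j , eq) = inj₂ (cong suc i≡j , eq)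

lower-All≤ : ∀ {r} x i {ys} → All (_≤ r) ys → All (_≤ r) (lower x i ys)
lower-All≤ x _       []         = []
lower-All≤ x zero    (y≤ ∷ ys≤) = ≤-trans (m⊓n≤n x _) y≤ ∷ ys≤
lower-All≤ x (suc i) (y≤ ∷ ys≤) = y≤ ∷ lower-All≤ x i ys≤

-- Counting the positions that survive a filter.

graph : (ℕ → ℕ) → ℕ → List (ℕ × ℕ)
graph f zero    = []
graph f (suc t) = (t , f t) ∷ graph f t

module _ {P : ℕ × ℕ → Set} (P? : Decidable P) (f : ℕ → ℕ) where

  length-filter-graph : ∀ s t → (∀ {i} → i < t → P (i , f i) → s ≤ i) →
                        length (filter P? (graph f t)) ≤ t ∸ s
  length-filter-graph s zero    s≤ = z≤n
  length-filter-graph s (suc t) s≤ with P? (t , f t)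
  ... | yes pt = ≤-trans (s≤s (length-filter-graph s t (s≤ ∘ m≤n⇒m≤1+n)))
                         (≤-reflexive (sym (+-∸-assoc 1 (s≤ ≤-refl pt))))
  ... | no _   = ≤-trans (length-filter-graph s t (s≤ ∘ m≤n⇒m≤1+n)) (∸-monoˡ-≤ s (n≤1+n t))

  -- Comparison with the newest survivor suffices: by `near`, all survivors lie among the `b`
  -- positions ending there.
  length-filter-graph-near :
    ∀ b t → (∀ {i j} → i < t → j < t → P (i , f i) → P (j , f j) → j < i + b) →
    length (filter P? (graph f t)) ≤ b
  length-filter-graph-near b zero    near = z≤n
  length-filter-graph-near b (suc t) near with P? (t , f t) in eq
  ... | no _   = length-filter-graph-near b t (λ i<t j<t → near (m≤n⇒m≤1+n i<t) (m≤n⇒m≤1+n j<t))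
  ... | yes pt = begin
    suc (length (filter P? (graph f t)))  ≤⟨ s≤s (length-filter-graph s t (from ∘ m≤n⇒m≤1+n)) ⟩
    suc (t ∸ s)                           ≡⟨ +-∸-assoc 1 (from ≤-refl pt) ⟨
    suc t ∸ s                             ≤⟨ m≤n+o⇒m∸n≤o (suc t) s
                                               (≤-trans (m≤n+m∸n (suc t) b) (≤-reflexive (+-comm b s))) ⟩
    b                                     ∎
    where
    open ≤-Reasoning
    s = suc t ∸ b
    from : ∀ {i} → i < suc t → P (i , f i) → s ≤ i
    from {i} i<1+t pi =
      m≤n+o⇒m∸n≤o (suc t) b (≤-trans (near i<1+t ≤-refl pi pt) (≤-reflexive (+-comm i b)))

-- Integer square roots.

integer-sqrt : ∀ n → Σ[ r ∈ ℕ ] (suc r * suc r ≤ suc n × suc n < suc (suc r) * suc (suc r))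
integer-sqrt zero    = 0 , s≤s z≤n , s≤s (s≤s z≤n)
integer-sqrt (suc n) with integer-sqrt n
... | r , lo , hi with suc (suc r) * suc (suc r) ≤? suc (suc n)
...   | yes lo′ = suc r , lo′ , <-≤-trans (s≤s hi)
                    (*-mono-< (n<1+n (suc (suc r))) (n<1+n (suc (suc r))))
...   | no ¬lo′ = r , m≤n⇒m≤1+n lo , ≰⇒> ¬lo′

<[1+m]²⇒≤4m² : ∀ {n} r → n < suc (suc r) * suc (suc r) → n ≤ 4 * (suc r * suc r)
<[1+m]²⇒≤4m² {n} r n< = begin
  n                              ≤⟨ <⇒≤ n< ⟩
  suc (suc r) * suc (suc r)      ≤⟨ *-mono-≤ 2+r≤ 2+r≤ ⟩
  (2 * suc r) * (2 * suc r)      ≡⟨ [m*n]*[o*p]≡[m*o]*[n*p] 2 (suc r) 2 (suc r) ⟩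
  4 * (suc r * suc r)            ∎
  where
  open ≤-Reasoning
  2+r≤ : suc (suc r) ≤ 2 * suc r
  2+r≤ = ≤-trans (s≤s (m≤n+m (suc r) r)) (≤-reflexive (cong (suc r +_) (sym (+-identityʳ (suc r)))))

-- Blocks compatible with the shift by K.

-- Every K positions are cut into L blocks of length b, the last one possibly
-- shorter.
module Blocks (k b′ : ℕ) where
  K b L : ℕ
  K = suc k
  b = suc b′
  -- As `K` is `suc k`, this is K / b rounded up.
  L = suc (k / b)

  q : ℕ → ℕ
  q i = (i / K) * L + (i % K) / b

  private
    split : ∀ i → i ≡ i % K + (i / K) * K
    split i = m≡m%n+[m/n]*n i K

  rest<L : ∀ i → (i % K) / b < L
  rest<L i = s≤s (/-monoˡ-≤ b (s≤s⁻¹ (m%n<n i K)))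

  -- Within one period of length `K` the remainder yields only the offsets 0, ..., L - 1, so every
  -- period has `L` indices of its own.
  q-mono-</K : ∀ i j → i / K < j / K → q i < q j
  q-mono-</K i j i/K<j/K = begin-strict
    (i / K) * L + (i % K) / b   <⟨ +-monoʳ-< ((i / K) * L) (rest<L i) ⟩
    (i / K) * L + L             ≡⟨ +-comm ((i / K) * L) L ⟩
    suc (i / K) * L             ≤⟨ *-monoˡ-≤ L i/K<j/K ⟩
    (j / K) * L                 ≤⟨ m≤m+n _ _ ⟩
    q j                         ∎
    where open ≤-Reasoning

  q-mono : ∀ {i j} → i ≤ j → q i ≤ q j
  q-mono {i} {j} i≤j with m≤n⇒m<n∨m≡n (/-monoˡ-≤ K i≤j)
  ... | inj₁ lt = <⇒≤ (q-mono-</K i j lt)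
  ... | inj₂ eq rewrite eq = +-monoʳ-≤ ((j / K) * L) (/-monoˡ-≤ b i%K≤j%K)
    where
    i%K≤j%K : i % K ≤ j % K
    i%K≤j%K = +-cancelʳ-≤ ((j / K) * K) _ _
      (subst₂ _≤_ (trans (split i) (cong (λ e → i % K + e * K) eq)) (split j) i≤j)

  q-shift : ∀ i → q (i + K) ≡ q i + L
  q-shift i = begin
    ((i + K) / K) * L + ((i + K) % K) / b   ≡⟨ cong₂ (λ u v → u * L + v / b) quotient ([m+n]%n≡m%n i K) ⟩
    L + (i / K) * L + (i % K) / b           ≡⟨ +-assoc L _ _ ⟩
    L + q i                                 ≡⟨ +-comm L (q i) ⟩
    q i + L                                 ∎
    where
    open ≡-Reasoning
    quotient : (i + K) / K ≡ suc (i / K)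
    quotient = trans (m/n≡1+[m∸n]/n (m≤n+m K i)) (cong (λ m → suc (m / K)) (m+n∸n≡m i K))

  -- Positions with equal index lie in the same period, and there their remainders have the same
  -- quotient by `b`. The bound has the form that `length-filter-graph-near` takes.
  q-fibre : ∀ {i j} → q i ≡ q j → j < i + b
  q-fibre {i} {j} qi≡qj with <-cmp (i / K) (j / K)
  ... | tri< lt _ _ = contradiction qi≡qj (<⇒≢ (q-mono-</K i j lt))
  ... | tri> _ _ gt = contradiction (sym qi≡qj) (<⇒≢ (q-mono-</K j i gt))
  ... | tri≈ _ eq _ = begin-strict
    j                                             ≡⟨ split j ⟩
    j % K + (j / K) * K                           ≡⟨ cong₂ _+_ (m≡m%n+[m/n]*n (j % K) b) (cong (_* K) (sym eq)) ⟩
    j % K % b + (j % K) / b * b + (i / K) * K     ≡⟨ cong (λ v → j % K % b + v * b + (i / K) * K) (sym same) ⟩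
    j % K % b + (i % K) / b * b + (i / K) * K     <⟨ +-monoˡ-< ((i / K) * K)
                                                       (+-mono-<-≤ (m%n<n (j % K) b) (m/n*n≤m (i % K) b)) ⟩
    b + i % K + (i / K) * K                       ≡⟨ +-assoc b _ _ ⟩
    b + (i % K + (i / K) * K)                     ≡⟨ cong (b +_) (sym (split i)) ⟩
    b + i                                         ≡⟨ +-comm b i ⟩
    i + b                                         ∎
    where
    open ≤-Reasoning
    same : (i % K) / b ≡ (j % K) / b
    same = +-cancelˡ-≡ ((i / K) * L) _ _
             (trans qi≡qj (cong (λ u → u * L + (j % K) / b) (sym eq)))

  -- `1 < L` gives b ≤ k, so the short last block of a period costs at most a factor 2: L * b ≤ 2 *
  -- K. For `L` = 1 the bound can fail, as each block is then a period, possibly much shorter than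
  -- `b`.
  q*b≤2* : 1 < L → ∀ i → q i * b ≤ 2 * i
  q*b≤2* (s≤s 1≤k/b) i = begin
    q i * b                                       ≡⟨ *-distribʳ-+ b ((i / K) * L) _ ⟩
    (i / K) * L * b + (i % K) / b * b             ≡⟨ cong (_+ (i % K) / b * b) (*-assoc (i / K) L b) ⟩
    (i / K) * (L * b) + (i % K) / b * b           ≤⟨ +-mono-≤ (*-monoʳ-≤ (i / K) L*b≤2K) (m/n*n≤m (i % K) b) ⟩
    (i / K) * (2 * K) + i % K                     ≤⟨ +-monoʳ-≤ ((i / K) * (2 * K)) (m≤n*m (i % K) 2) ⟩
    (i / K) * (2 * K) + 2 * (i % K)               ≡⟨ +-comm ((i / K) * (2 * K)) _ ⟩
    2 * (i % K) + (i / K) * (2 * K)               ≡⟨ cong (2 * (i % K) +_) (x∙yz≈y∙xz (i / K) 2 K) ⟩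
    2 * (i % K) + 2 * ((i / K) * K)               ≡⟨ *-distribˡ-+ 2 (i % K) _ ⟨
    2 * (i % K + (i / K) * K)                     ≡⟨ cong (2 *_) (sym (split i)) ⟩
    2 * i                                         ∎
    where
    open ≤-Reasoning
    open import Algebra.Properties.CommutativeSemigroup *-commutativeSemigroup using (x∙yz≈y∙xz)
    b≤k : b ≤ k
    b≤k = m/n≢0⇒n≤m (>⇒≢ 1≤k/b)
    L*b≤2K : L * b ≤ 2 * K
    L*b≤2K = +-mono-≤ (m≤n⇒m≤1+n b≤k)
               (≤-trans (m/n*n≤m k b) (≤-trans (n≤1+n k) (m≤m+n K 0)))

-- Membership in graphs, minima of lists, entries of the input.

∈-graph⁺ : ∀ f {i t} → i < t → (i , f i) ∈ graph f t
∈-graph⁺ f {i} {suc t} i<1+t with m≤n⇒m<n∨m≡n (s≤s⁻¹ i<1+t)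
... | inj₁ i<t  = there (∈-graph⁺ f i<t)
... | inj₂ refl = here refl

∈-graph⁻ : ∀ f {i x} t → (i , x) ∈ graph f t → i < t × x ≡ f i
∈-graph⁻ f (suc t) (here refl) = ≤-refl , refl
∈-graph⁻ f (suc t) (there i∈)  with ∈-graph⁻ f t i∈
... | i<t , eq = m≤n⇒m≤1+n i<t , eq

foldr-⊓-≤ : ∀ d {x xs} → x ∈ xs → foldr _⊓_ d xs ≤ x
foldr-⊓-≤ d {xs = y ∷ ys} (here refl) = m⊓n≤m y _
foldr-⊓-≤ d {xs = y ∷ ys} (there x∈)  = ≤-trans (m⊓n≤n y _) (foldr-⊓-≤ d x∈)

foldr-⊓-≤-init : ∀ d xs → foldr _⊓_ d xs ≤ d
foldr-⊓-≤-init d []       = ≤-refl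
foldr-⊓-≤-init d (x ∷ xs) = ≤-trans (m⊓n≤n x _) (foldr-⊓-≤-init d xs)

nth-replicate : ∀ d n j → nth d (replicate n d) j ≡ d
nth-replicate d zero    j       = refl
nth-replicate d (suc n) zero    = refl
nth-replicate d (suc n) (suc j) = nth-replicate d n j

values : ∀ {R N} → Vec (Value R) N → List ℕ
values A = map toℕ (toList A)

nth-values : ∀ {R N} (A : Vec (Value R) N) i → nth R (values A) (toℕ i) ≡ toℕ (lookup A i)
nth-values (x ∷ A) fzero    = refl
nth-values (x ∷ A) (fsuc i) = nth-values A i

nth-values-≤ : ∀ {R N} (A : Vec (Value R) N) i → nth R (values A) i ≤ R
nth-values-≤ []      i       = ≤-refl
nth-values-≤ (x ∷ A) zero    = s≤s⁻¹ (toℕ<n x)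
nth-values-≤ (x ∷ A) (suc i) = nth-values-≤ A i

drop-values : ∀ {R N} (A : Vec (Value R) N) {t} → t < N →
  Σ[ x ∈ Value R ] (toℕ x ≡ nth R (values A) t × drop t (toList A) ≡ x ∷ drop (suc t) (toList A))
drop-values (x ∷ A) {zero}  t<N       = x , refl , refl
drop-values (x ∷ A) {suc t} (s≤s t<N) = drop-values A t<N

-- The machine.

module SlidingMin (N K R L B : ℕ) (q : ℕ → ℕ) where

  -- t elements of the current pass have been read and w answers written; M lists
  -- the minima of the blocks 0, …, B - 1.  For L = 1 there may be more than B
  -- blocks, but then no minimum is ever looked at.
  data State : Set where
    first  : (t : ℕ) (M : List ℕ) → State
    second : (t w : ℕ) (M : List ℕ) (kept : List (ℕ × ℕ)) → State

  W : ℕ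
  W = suc (N ∸ K)

  -- Relevant means not covered.
  Covered : List ℕ → ℕ → ℕ → Set
  Covered M x Q = ∃[ j ] (j < Q + L × (Q < j × nth R M j ≤ x))

  TailCovered HeadCovered : List ℕ → ℕ → Set
  TailCovered M Q = Covered M (nth R M Q) Q
  HeadCovered M Q = Covered M (nth R M (Q + L)) Q

  -- c is the block of the element read last.
  Keep : List ℕ → ℕ → ℕ × ℕ → Set
  Keep M c (i , _) =
    (c ≤ q i ⊎ ¬ TailCovered M (q i)) × (∀ {Q} → Q < c → q i < Q → TailCovered M Q)

  -- `t` is the next position to be read, so `q w < q t` says that the tail has been read in full.
  Ready : List ℕ → ℕ → ℕ → Set
  Ready M t w = w + K ≤ t ⊎ (q w < q t × HeadCovered M (q w))

  covered? : ∀ M x Q → Dec (Covered M x Q)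
  covered? M x Q = anyUpTo? (λ j → (Q <? j) ×-dec (nth R M j ≤? x)) (Q + L)

  keep? : ∀ M c → Decidable (Keep M c)
  keep? M c (i , _) =
    ((c ≤? q i) ⊎-dec ¬? (covered? M (nth R M (q i)) (q i))) ×-dec
    allUpTo? (λ Q → (q i <? Q) →-dec covered? M (nth R M Q) Q) c

  ready? : ∀ M t w → Dec (Ready M t w)
  ready? M t w =
    (w + K ≤? t) ⊎-dec ((q w <? q t) ×-dec covered? M (nth R M (q w + L)) (q w))

  inWindow? : ∀ w → Decidable {A = ℕ × ℕ} (λ (i , _) → w ≤ i × i < w + K)
  inWindow? w (i , _) = (w ≤? i) ×-dec (i <? w + K)

  known : List ℕ → List (ℕ × ℕ) → ℕ → List ℕ
  known M kept w =
    map proj₂ (filter (inWindow? w) kept) ++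
    map (nth R M) (filter (q w <?_) (upTo (q w + L)))

  -- The fold starts at `R`, so the result lies in [0,R] whatever the memory contains.
  answer : List ℕ → List (ℕ × ℕ) → ℕ → Value R
  answer M kept w = fromℕ< (s≤s (foldr-⊓-≤-init R (known M kept w)))

  serialize : State → List ℕ
  serialize (first t M)         = 0 ∷ t ∷ M
  serialize (second t w M kept) = 1 ∷ t ∷ w ∷ M ++ flatten kept

  deserialize : List ℕ → State
  deserialize (zero  ∷ t ∷ M)      = first t M
  deserialize (suc _ ∷ t ∷ w ∷ ns) = second t w (take B ns) (pairUp (drop B ns))
  deserialize _                    = first 0 []

  store : State → Memory
  store = encode ∘ serialize

  -- The end of a scan gives no signal, so the pass changes when the count reaches `N`.
  start : ℕ → List ℕ → State
  start t M with t <? N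
  ... | yes _ = first t M
  ... | no _  = second 0 0 M []

  next : State → Action R
  next (first t M) = read λ x → store (start (suc t) (lower (toℕ x) (q t) M))
  -- Writing has priority: the second scan advances only while the pending answer is not ready, on
  -- which `quiet-suc-t` relies.
  next (second t w M kept) with w <? W | ready? M t w
  ... | no _  | _     = halt
  ... | yes _ | yes _ = write (answer M kept w) (store (second t (suc w) M kept))
  ... | yes _ | no _  =
    read λ x → store (second (suc t) w M (filter (keep? M (q t)) ((t , toℕ x) ∷ kept)))

  machine : Machine R
  machine = record
    { init = store (start 0 (replicate B R))
    ; step = next ∘ deserialize ∘ decode
    }

  minima : State → List ℕ
  minima (first _ M)      = M
  minima (second _ _ M _) = M

  -- `M` and `kept` are serialized without a separator; the length `B` of `M` tells where to cut.
  step-store : ∀ s → length (minima s) ≡ B → Machine.step machine (store s) ≡ next s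
  step-store s eq = cong next (trans (cong deserialize (decode-encode (serialize s))) (roundtrip s eq))
    where
    roundtrip : ∀ s → length (minima s) ≡ B → deserialize (serialize s) ≡ s
    roundtrip (first t M)         _    = refl
    roundtrip (second t w M kept) refl = cong₂ (second t w)
      (take-length M (flatten kept))
      (trans (cong pairUp (drop-length M (flatten kept))) (pairUp-flatten kept))

  next-halt : ∀ {t w M kept} → ¬ w < W → next (second t w M kept) ≡ halt
  next-halt {t} {w} {M} w≮W with w <? W | ready? M t w
  ... | no _    | _ = refl
  ... | yes w<W | _ = contradiction w<W w≮W

  next-write : ∀ {t w M kept} → w < W → Ready M t w →
    next (second t w M kept) ≡ write (answer M kept w) (store (second t (suc w) M kept))
  next-write {t} {w} {M} w<W ready with w <? W | ready? M t w
  ... | no w≮W | _         = contradiction w<W w≮W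
  ... | yes _  | yes _     = refl
  ... | yes _  | no ¬ready = contradiction ready ¬ready

  next-read : ∀ {t w M kept} → w < W → ¬ Ready M t w →
    next (second t w M kept) ≡
    read λ x → store (second (suc t) w M (filter (keep? M (q t)) ((t , toℕ x) ∷ kept)))
  next-read {t} {w} {M} w<W ¬ready with w <? W | ready? M t w
  ... | no w≮W | _         = contradiction w<W w≮W
  ... | yes _  | yes ready = contradiction ready ¬ready
  ... | yes _  | no _      = refl

  -- Correctness and space of the machine.

  module Correctness
    (b : ℕ) (1≤K : 1 ≤ K) (K≤N : K ≤ N) (0<L : 0 < L)
    (q-mono  : ∀ {i j} → i ≤ j → q i ≤ q j)
    (q-shift : ∀ i → q (i + K) ≡ q i + L)
    (q-fibre : ∀ {i j} → q i ≡ q j → j < i + b)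
    (q<B     : 1 < L → ∀ {i} → i < N → q i < B)
    (A : Vec (Value R) N) where

    a : ℕ → ℕ
    a = nth R (values A)

    q-cancel-< : ∀ {i j} → q i < q j → i < j
    q-cancel-< qi<qj = ≰⇒> λ j≤i → <⇒≱ qi<qj (q-mono j≤i)

    -- Entries start at `R`, which `nth` also returns beyond the list; hence the first alternative
    -- of `attained`. `below` is limited to indices under `B` because for `L` = 1 the blocks may
    -- outnumber the entries.
    record Minima (t : ℕ) (M : List ℕ) : Set where
      field
        size     : length M ≡ B
        bounded  : All (_≤ R) M
        below    : ∀ {i} → i < t → q i < B → nth R M (q i) ≤ a i
        attained : ∀ j → nth R M j ≡ R ⊎ ∃[ i ] (i < t × q i ≡ j × a i ≡ nth R M j)

    minima-replicate : Minima 0 (replicate B R)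
    minima-replicate = record
      { size     = length-replicate B
      ; bounded  = All.replicate⁺ B ≤-refl
      ; below    = λ ()
      ; attained = λ j → inj₁ (nth-replicate R B j)
      }

    minima-lower : ∀ {t M} → Minima t M → Minima (suc t) (lower (a t) (q t) M)
    minima-lower {t} {M} mins = record
      { size     = trans (length-lower (a t) (q t) M) size
      ; bounded  = lower-All≤ (a t) (q t) bounded
      ; below    = below′
      ; attained = attained′
      }
      where
      open Minima mins
      below′ : ∀ {i} → i < suc t → q i < B → nth R (lower (a t) (q t) M) (q i) ≤ a i
      below′ {i} i<1+t qi<B with m≤n⇒m<n∨m≡n (s≤s⁻¹ i<1+t)
      ... | inj₁ i<t  = ≤-trans (nth-lower-≤ R (a t) (q t) M (q i)) (below i<t qi<B)
      ... | inj₂ refl = nth-lower-≤-new R (a t) (q t) M (subst (q i <_) (sym size) qi<B)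
      attained′ : ∀ j → nth R (lower (a t) (q t) M) j ≡ R ⊎
                  ∃[ i ] (i < suc t × q i ≡ j × a i ≡ nth R (lower (a t) (q t) M) j)
      attained′ j with nth-lower-sel R (a t) (q t) M j
      ... | inj₂ (qt≡j , eq) = inj₂ (t , ≤-refl , qt≡j , eq)
      ... | inj₁ eq with attained j
      ...   | inj₁ ≡R                    = inj₁ (trans eq ≡R)
      ...   | inj₂ (i , i<t , qi≡j , eq′) = inj₂ (i , m≤n⇒m≤1+n i<t , qi≡j , trans eq′ (sym eq))

    -- The elements stored in the second pass.

    kept : List ℕ → ℕ → List (ℕ × ℕ)
    -- `pred t` is the position read last. At `t` = 0 the graph is empty, so `q (pred 0)` is
    -- harmless.
    kept M t = filter (keep? M (q (pred t))) (graph a t)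

    ∈-kept⁻ : ∀ {M t i x} → (i , x) ∈ kept M t → i < t × x ≡ a i
    ∈-kept⁻ {M} {t} i∈ = ∈-graph⁻ a t (proj₁ (∈-filter⁻ (keep? M (q (pred t))) {xs = graph a t} i∈))

    -- `Keep` only gets harder to satisfy as the current block advances (`weaken`), so no element
    -- discarded earlier would be kept now.
    kept-suc : ∀ M t → filter (keep? M (q t)) ((t , a t) ∷ kept M t) ≡ kept M (suc t)
    kept-suc M t = filter-∷-filter (keep? M (q t)) (keep? M (q (pred t))) (λ {x} → weaken {x}) (t , a t) (graph a t)
      where
      earlier : q (pred t) ≤ q t
      earlier = q-mono (pred[n]≤n {t})
      weaken : ∀ {x} → Keep M (q t) x → Keep M (q (pred t)) x
      weaken (recent , quiet) =
        Sum.map₁ (≤-trans earlier) recent , λ Q<c → quiet (<-≤-trans Q<c earlier)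

    -- At most `b` elements belong to the current block, and at most `b` are saved from earlier
    -- ones. The saved ones share a block: of two saved blocks the later has a relevant tail,
    -- whereas keeping the earlier requires all tails between it and the current block to be
    -- irrelevant.
    length-kept : ∀ M t → length (kept M t) ≤ b + b
    length-kept M t = ≤-trans
      (length-filter-split (keep? M c) current? saved? (λ {x} → split {x}) (graph a t))
      (+-mono-≤ (length-filter-graph-near current? a b t current-near)
                (length-filter-graph-near saved? a b t saved-near))
      where
      c = q (pred t)
      Current Saved : ℕ × ℕ → Set
      Current (i , _) = c ≤ q i
      Saved   x       = q (proj₁ x) < c × Keep M c x
      current? : Decidable Current
      current? (i , _) = c ≤? q i
      saved? : Decidable Saved
      saved? x = (q (proj₁ x) <? c) ×-dec keep? M c x
      split : ∀ {x} → Keep M c x → Current x ⊎ Saved x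
      split {i , _} keep with c ≤? q i
      ... | yes c≤ = inj₁ c≤
      ... | no c≰  = inj₂ (≰⇒> c≰ , keep)
      current-block : ∀ {i} → i < t → c ≤ q i → q i ≡ c
      current-block i<t c≤ = ≤-antisym (q-mono (<⇒≤pred i<t)) c≤
      current-near : ∀ {i j} → i < t → j < t → c ≤ q i → c ≤ q j → j < i + b
      current-near i<t j<t ci cj = q-fibre (trans (current-block i<t ci) (sym (current-block j<t cj)))
      not-before : ∀ {i j} → Saved (i , a i) → Saved (j , a j) → ¬ q i < q j
      not-before (_ , _ , quiet) (qj<c , inj₁ c≤qj , _)     _     = <⇒≱ qj<c c≤qj
      not-before (_ , _ , quiet) (qj<c , inj₂ ¬covered , _) qi<qj = ¬covered (quiet qj<c qi<qj)
      saved-near : ∀ {i j} → i < t → j < t → Saved (i , a i) → Saved (j , a j) → j < i + b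
      saved-near _ _ si sj = q-fibre (≤-antisym (≮⇒≥ (not-before sj si)) (≮⇒≥ (not-before si sj)))

    -- Correctness of a single answer.

    Quiet : List ℕ → ℕ → ℕ → Set
    Quiet M t w = ∀ {Q} → q w < Q → Q < q (pred t) → TailCovered M Q

    window-fits : ∀ {w} → w < W → w + K ≤ N
    window-fits {w} w<W = subst (w + K ≤_) (m∸n+n≡m K≤N) (+-monoˡ-≤ K (s≤s⁻¹ w<W))

    q-window : ∀ w → q w < q (w + K)
    q-window w = subst (q w <_) (sym (q-shift w)) (m<m+n (q w) 0<L)

    module _ {M t w} (mins : Minima N M) (t≤w+K : t ≤ w + K) (w<W : w < W)
             (quiet : Quiet M t w) (ready : Ready M t w) where
      open Minima mins

      v : ℕ
      v = foldr _⊓_ R (known M (kept M t) w)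

      w+K≤N : w + K ≤ N
      w+K≤N = window-fits w<W

      -- An index strictly between `q w` and `q w + L` forces `L` > 1, and then the list of minima
      -- covers all blocks of the input.
      below′ : ∀ {j i} → q w < j → j < q w + L → i < N → nth R M (q i) ≤ a i
      below′ {j} qw<j j<qw+L i<N = below i<N (q<B 1<L i<N)
        where
        1<L : 1 < L
        1<L = +-cancelˡ-< (q w) 1 L (≤-<-trans (≤-trans (≤-reflexive (+-comm (q w) 1)) qw<j) j<qw+L)

      v≤minimum : ∀ {j} → q w < j → j < q w + L → v ≤ nth R M j
      v≤minimum qw<j j<qw+L = foldr-⊓-≤ R
        (∈-++⁺ʳ (map proj₂ (filter (inWindow? w) (kept M t)))
          (∈-map⁺ (nth R M) (∈-filter⁺ (q w <?_) (∈-upTo⁺ j<qw+L) qw<j)))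

      v≤kept : ∀ {i} → w ≤ i → i < w + K → i < t → Keep M (q (pred t)) (i , a i) → v ≤ a i
      v≤kept w≤i i<w+K i<t keep = foldr-⊓-≤ R
        (∈-++⁺ˡ (∈-map⁺ proj₂ (∈-filter⁺ (inWindow? w)
          (∈-filter⁺ (keep? M (q (pred t))) (∈-graph⁺ a i<t) keep) (w≤i , i<w+K))))

      -- Elements of `Q` are at least its minimum, which is at least that of a block in the middle
      -- of the window, already counted in `v`.
      v≤covered : ∀ {i Q} → i < N → q i ≡ Q → Covered M (nth R M Q) (q w) → v ≤ a i
      v≤covered i<N refl (j , j<qw+L , qw<j , Mj≤) =
        ≤-trans (v≤minimum qw<j j<qw+L) (≤-trans Mj≤ (below′ qw<j j<qw+L i<N))

      tail-read : Ready M t w → q w < q t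
      tail-read (inj₁ w+K≤t)       = <-≤-trans (q-window w) (q-mono w+K≤t)
      tail-read (inj₂ (qw<qt , _)) = qw<qt

      -- An irrelevant tail is outweighed by the blocks in between. A relevant one has been read,
      -- and by `quiet` no relevant tail of a later block has displaced it.
      v≤tail : ∀ {i} → w ≤ i → i < w + K → q i ≡ q w → v ≤ a i
      v≤tail {i} w≤i i<w+K qi≡qw with covered? M (nth R M (q w)) (q w)
      ... | yes cov = v≤covered (<-≤-trans i<w+K w+K≤N) qi≡qw cov
      ... | no ¬cov = v≤kept w≤i i<w+K (q-cancel-< (subst (_< q t) (sym qi≡qw) (tail-read ready)))
        ( inj₂ (subst (λ Q → ¬ TailCovered M Q) (sym qi≡qw) ¬cov)
        , λ Q<c qi<Q → quiet (subst (_< _) qi≡qw qi<Q) Q<c )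

      -- If readiness comes from an irrelevant head, the blocks in between suffice. If it comes from
      -- having read the window, `t ≤ w + K` keeps the block read last from exceeding `q w + L`, so
      -- head elements still pass as current in `Keep`.
      v≤head : Ready M t w → ∀ {i} → w ≤ i → i < w + K → q i ≡ q w + L → v ≤ a i
      v≤head (inj₂ (_ , cov)) w≤i i<w+K qi≡qw+L = v≤covered (<-≤-trans i<w+K w+K≤N) qi≡qw+L cov
      v≤head (inj₁ w+K≤t) {i} w≤i i<w+K qi≡qw+L = v≤kept w≤i i<w+K (<-≤-trans i<w+K w+K≤t)
        (inj₁ c≤qi , λ Q<c qi<Q → contradiction (<-≤-trans Q<c c≤qi) (<-asym qi<Q))
        where
        c≤qi : q (pred t) ≤ q i
        c≤qi = ≤-trans (q-mono (≤-trans (pred[n]≤n {t}) t≤w+K))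
                       (≤-reflexive (trans (q-shift w) (sym qi≡qw+L)))

      v≤ : ∀ {i} → w ≤ i → i < w + K → v ≤ a i
      v≤ {i} w≤i i<w+K with m≤n⇒m<n∨m≡n (q-mono w≤i)
      ... | inj₂ qw≡qi = v≤tail w≤i i<w+K (sym qw≡qi)
      ... | inj₁ qw<qi with m≤n⇒m<n∨m≡n (subst (q i ≤_) (q-shift w) (q-mono (<⇒≤ i<w+K)))
      ...   | inj₁ qi<qw+L = ≤-trans (v≤minimum qw<qi qi<qw+L) (below′ qw<qi qi<qw+L (<-≤-trans i<w+K w+K≤N))
      ...   | inj₂ qi≡qw+L = v≤head ready w≤i i<w+K qi≡qw+L

      w<w+K : w < w + K
      w<w+K = m<m+n w 1≤K

      -- `R` may be just the initial value of the fold, but then the first element of the window is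
      -- squeezed between `v` and `R`.
      v≡R⇒attained : v ≡ R → ∃[ i ] (w ≤ i × i < w + K × a i ≡ v)
      v≡R⇒attained v≡R = w , ≤-refl , w<w+K ,
        ≤-antisym (subst (a w ≤_) (sym v≡R) (nth-values-≤ A w)) (v≤ ≤-refl w<w+K)

      -- A block minimum is attained at a position whose block lies strictly between those of `w`
      -- and `w + K`; monotonicity of `q` places the position in the window.
      v-attained : ∃[ i ] (w ≤ i × i < w + K × a i ≡ v)
      v-attained with foldr-selective ⊓-sel R (known M (kept M t) w)
      ... | inj₁ v≡R = v≡R⇒attained v≡R
      ... | inj₂ v∈ with ∈-++⁻ (map proj₂ (filter (inWindow? w) (kept M t))) v∈
      ...   | inj₁ v∈kept with ∈-map⁻ proj₂ v∈kept
      ...     | (i , x) , i∈ , v≡x with ∈-filter⁻ (inWindow? w) {xs = kept M t} i∈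
      ...       | i∈kept , w≤i , i<w+K =
                  i , w≤i , i<w+K , sym (trans v≡x (proj₂ (∈-kept⁻ {M} {t} i∈kept)))
      v-attained | inj₂ v∈ | inj₂ v∈minima with ∈-map⁻ (nth R M) v∈minima
      ... | j , j∈ , v≡Mj with ∈-filter⁻ (q w <?_) {xs = upTo (q w + L)} j∈
      ...   | j∈upTo , qw<j with attained j
      ...     | inj₁ Mj≡R = v≡R⇒attained (trans v≡Mj Mj≡R)
      ...     | inj₂ (i , _ , refl , ai≡Mj) =
                i , <⇒≤ (q-cancel-< qw<j)
                  , q-cancel-< (subst (q i <_) (sym (q-shift w)) (∈-upTo⁻ j∈upTo))
                  , trans ai≡Mj (sym v≡Mj)

      answer-correct : IsWindowMin A K w (answer M (kept M t) w)
      answer-correct = attain v-attained , minimal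
        where
        toℕ-answer : toℕ (answer M (kept M t) w) ≡ v
        toℕ-answer = toℕ-fromℕ< _
        attain : ∃[ i ] (w ≤ i × i < w + K × a i ≡ v) →
                 ∃[ i ] InWindow K w i × lookup A i ≡ answer M (kept M t) w
        attain (i , w≤i , i<w+K , ai≡v) =
          fi , subst (λ n → w ≤ n × n < w + K) (sym toℕ-fi) (w≤i , i<w+K)
             , toℕ-injective (begin
                 toℕ (lookup A fi)                    ≡⟨ nth-values A fi ⟨
                 a (toℕ fi)                           ≡⟨ cong a toℕ-fi ⟩
                 a i                                  ≡⟨ ai≡v ⟩
                 v                                    ≡⟨ toℕ-answer ⟨
                 toℕ (answer M (kept M t) w)          ∎)
          where
          open ≡-Reasoning
          i<N : i < N
          i<N = <-≤-trans i<w+K w+K≤N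
          fi : Fin N
          fi = fromℕ< i<N
          toℕ-fi : toℕ fi ≡ i
          toℕ-fi = toℕ-fromℕ< i<N
        minimal : ∀ i → InWindow K w i → toℕ (answer M (kept M t) w) ≤ toℕ (lookup A i)
        minimal i (w≤i , i<w+K) =
          subst₂ _≤_ (sym toℕ-answer) (nth-values A i) (v≤ w≤i i<w+K)

    quiet-suc-w : ∀ {M t w} → Quiet M t w → Quiet M t (suc w)
    quiet-suc-w {w = w} quiet qw′<Q = quiet (≤-<-trans (q-mono (n≤1+n w)) qw′<Q)

    -- With `Q` between `q w` and `q t`, the tail of `q w` has been read, so an unready answer means
    -- that the head is relevant and its minimum is below that of `Q`. Each read thus establishes
    -- `Quiet` afresh.
    quiet-suc-t : ∀ {M t w} → ¬ Ready M t w → Quiet M (suc t) w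
    quiet-suc-t {M} {t} {w} ¬ready {Q} qw<Q Q<qt =
      -- The head block itself covers the tail of `Q`; it comes before block `Q + L` because q w <
      -- Q.
      q w + L , +-monoˡ-< L qw<Q , Q<qw+L ,
      ≮⇒≥ λ MQ<Mhead → ¬ready (inj₂ (<-trans qw<Q Q<qt , Q , Q<qw+L , qw<Q , <⇒≤ MQ<Mhead))
      where
      t<w+K : t < w + K
      t<w+K = ≰⇒> (¬ready ∘ inj₁)
      Q<qw+L : Q < q w + L
      Q<qw+L = <-≤-trans Q<qt (subst (q t ≤_) (q-shift w) (q-mono (<⇒≤ t<w+K)))

    -- Space of a single state.

    ℓ S : ℕ
    ℓ = ⌈log₂ suc R ⌉ + ⌈log₂ suc N ⌉
    -- Three numbers for the pass, `t` and `w`, then `B` minima and two numbers for each of at most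
    -- 2b stored elements, at two bits per digit and one terminator per number.
    S = (3 + B + (b + b) * 2) * (1 + 2 * ℓ)

    Small : ℕ → Set
    Small n = ⌈log₂ suc n ⌉ ≤ ℓ

    ≤R⇒small : ∀ {n} → n ≤ R → Small n
    ≤R⇒small {n} n≤R = ≤-trans (⌈log₂⌉-mono-≤ (s≤s n≤R)) (m≤m+n _ _)

    ≤N⇒small : ∀ {n} → n ≤ N → Small n
    ≤N⇒small {n} n≤N = ≤-trans (⌈log₂⌉-mono-≤ (s≤s n≤N)) (m≤n+m _ _)

    length-store-first : ∀ {t M} → t ≤ N → Minima t M → length (store (first t M)) ≤ S
    length-store-first {t} {M} t≤N mins = ≤-trans
      (length-encode (serialize (first t M)) (≤R⇒small {0} z≤n ∷ ≤N⇒small {t} t≤N ∷ All.map (λ {n} → ≤R⇒small {n}) bounded))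
      (*-monoˡ-≤ (1 + 2 * ℓ) (begin
        2 + length M             ≡⟨ cong (2 +_) size ⟩
        2 + B                    ≤⟨ n≤1+n _ ⟩
        3 + B                    ≤⟨ m≤m+n _ _ ⟩
        3 + B + (b + b) * 2      ∎))
      where
      open Minima mins
      open ≤-Reasoning

    length-store-second : ∀ {t w M} → t ≤ N → w ≤ W → Minima N M →
                          length (store (second t w M (kept M t))) ≤ S
    length-store-second {t} {w} {M} t≤N w≤W mins = ≤-trans
      (length-encode (serialize (second t w M (kept M t))) (≤N⇒small {1} (≤-trans 1≤K K≤N) ∷ ≤N⇒small {t} t≤N ∷ ≤N⇒small {w} w≤N ∷
        All.++⁺ (All.map (λ {n} → ≤R⇒small {n}) bounded) (All-flatten (All.tabulate small))))
      (*-monoˡ-≤ (1 + 2 * ℓ) (begin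
        3 + length (M ++ flatten (kept M t))              ≡⟨ cong (3 +_) (length-++ M) ⟩
        3 + (length M + length (flatten (kept M t)))      ≡⟨ +-assoc 3 (length M) _ ⟨
        3 + length M + length (flatten (kept M t))        ≡⟨ cong₂ (λ m n → 3 + m + n) size (length-flatten (kept M t)) ⟩
        3 + B + length (kept M t) * 2                     ≤⟨ +-monoʳ-≤ (3 + B) (*-monoˡ-≤ 2 (length-kept M t)) ⟩
        3 + B + (b + b) * 2                               ∎))
      where
      open Minima mins
      open ≤-Reasoning
      w≤N : w ≤ N
      w≤N = ≤-trans w≤W (∸-monoʳ-< 1≤K K≤N)
      small : ∀ {x} → x ∈ kept M t → Small (proj₁ x) × Small (proj₂ x)
      small {i , _} x∈ with ∈-kept⁻ {M} {t} x∈
      ... | i<t , refl = ≤N⇒small {i} (≤-trans (<⇒≤ i<t) t≤N) , ≤R⇒small {a i} (nth-values-≤ A i)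

    -- Runs through the two passes.

    Result : ℕ → ℕ → State → List (Value R) → Set
    Result r w s xs =
      Σ[ out ∈ Vec (Value R) r ]
        ((∀ i → IsWindowMin A K (w + toℕ i) (lookup out i)) ×
         (Σ[ run ∈ Run machine (store s) xs (toList out) ] space run ≤ S))

    result-read : ∀ s s′ {r w x xs f} → length (store s) ≤ S →
                  Machine.step machine (store s) ≡ read f →
                  f x ≡ store s′ → Result r w s′ xs → Result r w s (x ∷ xs)
    result-read s s′ {x = x} {xs} {f} small eq fx≡ (out , correct , run , space≤) =
      out , correct , go fx≡ run space≤
      where
      -- The memory becomes a variable so that the equation can be matched and the space bound
      -- follows the run.
      go : ∀ {m} → f x ≡ m → (run : Run machine m xs (toList out)) → space run ≤ S →
           Σ[ run ∈ Run machine (store s) (x ∷ xs) (toList out) ] space run ≤ S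
      go refl run space≤ = reads eq run , ⊔-lub small space≤

    unread : ℕ → List (Value R)
    unread t = drop t (toList A)

    -- Induction on the unread elements `d` and the outstanding answers `r`: a read lowers `d`, a
    -- write lowers `r`.
    second-pass : ∀ d r {t w M} → t + d ≡ N → w + r ≡ W → Minima N M → t ≤ w + K →
                  Quiet M t w → Result r w (second t w M (kept M t)) (unread t ++ [])
    second-pass d zero {t} {w} {M} t+d≡N w+0≡W mins t≤w+K quiet =
      [] , (λ ()) ,
      halted (trans (step-store (second t w M (kept M t)) (Minima.size mins)) (next-halt (≤⇒≯ (≤-reflexive (sym w≡W))))) ,
      length-store-second (m+n≤o⇒m≤o t (≤-reflexive t+d≡N)) (≤-reflexive w≡W) mins
      where
      w≡W : w ≡ W
      w≡W = trans (sym (+-identityʳ w)) w+0≡W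
    second-pass d (suc r) {t} {w} {M} t+d≡N w+r≡W mins t≤w+K quiet = go (ready? M t w)
      where
      w<W : w < W
      w<W = m+n≤o⇒m≤o (suc w) (≤-reflexive (trans (sym (+-suc w r)) w+r≡W))
      t≤N : t ≤ N
      t≤N = m+n≤o⇒m≤o t (≤-reflexive t+d≡N)
      small = length-store-second t≤N (<⇒≤ w<W) mins
      step≡ = step-store (second t w M (kept M t)) (Minima.size mins)
      go : Dec (Ready M t w) → Result (suc r) w (second t w M (kept M t)) (unread t ++ [])
      go (yes ready)
        with second-pass d r {t} {suc w} t+d≡N (trans (sym (+-suc w r)) w+r≡W) mins
               (m≤n⇒m≤1+n t≤w+K) (quiet-suc-w {M} {t} quiet)
      ... | out , correct , run , space≤ =
        answer M (kept M t) w ∷ out , correct′ ,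
        writes (trans step≡ (next-write w<W ready)) run , ⊔-lub small space≤
        where
        correct′ : ∀ i → IsWindowMin A K (w + toℕ i) (lookup (answer M (kept M t) w ∷ out) i)
        correct′ fzero    = subst (λ n → IsWindowMin A K n (answer M (kept M t) w)) (sym (+-identityʳ w))
                              (answer-correct {M} {t} mins t≤w+K w<W quiet ready)
        correct′ (fsuc i) = subst (λ n → IsWindowMin A K n (lookup out i)) (sym (+-suc w (toℕ i))) (correct i)
      go (no ¬ready) = reading d t+d≡N
        where
        t<w+K : t < w + K
        t<w+K = ≰⇒> (¬ready ∘ inj₁)
        t<N : t < N
        t<N = <-≤-trans t<w+K (window-fits w<W)
        reading : ∀ d → t + d ≡ N → Result (suc r) w (second t w M (kept M t)) (unread t ++ [])
        -- An unready answer leaves part of its window unread, so the scan cannot be exhausted.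
        reading zero    t+0≡N = contradiction (trans (sym (+-identityʳ t)) t+0≡N) (<⇒≢ t<N)
        reading (suc d) t+1+d≡N with drop-values A t<N
        ... | x , x≡at , drop≡ = subst (λ xs → Result (suc r) w (second t w M (kept M t)) (xs ++ [])) (sym drop≡)
          (result-read (second t w M (kept M t)) (second (suc t) w M (kept M (suc t))) small (trans step≡ (next-read w<W ¬ready))
            (cong (store ∘ second (suc t) w M)
              (trans (cong (λ y → filter (keep? M (q t)) ((t , y) ∷ kept M t)) x≡at) (kept-suc M t)))
            (second-pass d (suc r) (trans (sym (+-suc t d)) t+1+d≡N) w+r≡W mins t<w+K
              (quiet-suc-t {M} ¬ready)))

    first-pass : ∀ d {t M} → t + d ≡ N → Minima t M →
                 Result W 0 (start t M) (unread t ++ (unread 0 ++ []))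
    first-pass d {t} {M} t+d≡N mins with t <? N
    first-pass zero {t} t+0≡N mins | yes t<N =
      contradiction (trans (sym (+-identityʳ t)) t+0≡N) (<⇒≢ t<N)
    first-pass (suc d) {t} {M} t+1+d≡N mins | yes t<N with drop-values A t<N
    ... | x , x≡at , drop≡ = subst (λ xs → Result W 0 (first t M) (xs ++ (unread 0 ++ []))) (sym drop≡)
      (result-read (first t M) (start (suc t) (lower (a t) (q t) M)) (length-store-first (<⇒≤ t<N) mins)
        (step-store (first t M) (Minima.size mins))
        (cong (λ y → store (start (suc t) (lower y (q t) M))) x≡at)
        (first-pass d (trans (sym (+-suc t d)) t+1+d≡N) (minima-lower mins)))
    first-pass d {t} {M} t+d≡N mins | no t≮N =
      subst (λ xs → Result W 0 (second 0 0 M []) (xs ++ (unread 0 ++ []))) (sym all-read)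
        (second-pass N W refl refl (subst (λ n → Minima n M) t≡N mins) z≤n (λ {Q} → no-block {Q}))
      where
      t≡N : t ≡ N
      t≡N = ≤-antisym (m+n≤o⇒m≤o t (≤-reflexive t+d≡N)) (≮⇒≥ t≮N)
      -- With `w` and `pred 0` both 0, no block lies strictly between, so the second pass starts
      -- quiet.
      no-block : ∀ {Q} → q 0 < Q → Q < q 0 → TailCovered M Q
      no-block q0<Q Q<q0 = contradiction Q<q0 (<-asym q0<Q)
      all-read : unread t ≡ []
      all-read = drop-all t (toList A) (subst (_≤ t) (sym (length-toList A)) (≮⇒≥ t≮N))

    solves : Result W 0 (start 0 (replicate B R)) (passes 2 A)
    solves = first-pass N refl minima-replicate

-- Choice of the block length and the constant.

algorithm : Algorithm
-- `b` is the integer square root of N = `suc n`, a positive number. For `L` > 1 there are at most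
-- 8b blocks, as q i * b ≤ 2i < 2N ≤ 8b².
algorithm (suc n) (suc k) R = SlidingMin.machine (suc n) (suc k) R L (8 * b) q
  where open Blocks k (proj₁ (integer-sqrt n))
algorithm _       _       R = record { init = [] ; step = λ _ → halt }

proposition3p1 : Σ[ c ∈ ℕ ] Σ[ alg ∈ Algorithm ]
    ((N K R : ℕ) → 1 ≤ K → K ≤ N → (A : Vec (Value R) N) →
    Σ[ out ∈ Vec (Value R) (suc (N ∸ K)) ]
    (IsSlidingMin K A out ×
    (Σ[ run ∈ Execution (alg N K R) (passes 2 A) (toList out) ]
    (space run ≤ c * (⌈log₂ suc R ⌉ + ⌈log₂ suc N ⌉) ·√ N))))
-- 45 = (3 + 8 + 4) · 3: as b and ℓ are at least 1, the 3 + 8b + 4b numbers are at most 15b, and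
-- each takes 1 + 2ℓ ≤ 3ℓ bits.
proposition3p1 = 45 , algorithm , correct
  where
  correct : (N K R : ℕ) → 1 ≤ K → K ≤ N → (A : Vec (Value R) N) →
    Σ[ out ∈ Vec (Value R) (suc (N ∸ K)) ]
    (IsSlidingMin K A out ×
    (Σ[ run ∈ Execution (algorithm N K R) (passes 2 A) (toList out) ]
    (space run ≤ 45 * (⌈log₂ suc R ⌉ + ⌈log₂ suc N ⌉) ·√ N)))
  correct (suc n) (suc k) R 1≤K K≤N A =
    let out , minima , run , space≤S = solves in out , minima , run , bound space≤S
    where
    r : ℕ
    r = proj₁ (integer-sqrt n)
    open Blocks k r
    b*b≤N : b * b ≤ suc n
    b*b≤N = proj₁ (proj₂ (integer-sqrt n))
    N≤4*b*b : suc n ≤ 4 * (b * b)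
    N≤4*b*b = <[1+m]²⇒≤4m² r (proj₂ (proj₂ (integer-sqrt n)))
    open ≤-Reasoning
    q<8*b : 1 < L → ∀ {i} → i < suc n → q i < 8 * b
    q<8*b 1<L {i} i<N = *-cancelʳ-< b (q i) (8 * b) (begin-strict
      q i * b              ≤⟨ q*b≤2* 1<L i ⟩
      2 * i                <⟨ *-monoʳ-< 2 i<N ⟩
      2 * suc n            ≤⟨ *-monoʳ-≤ 2 N≤4*b*b ⟩
      2 * (4 * (b * b))    ≡⟨ *-assoc 2 4 (b * b) ⟨
      8 * (b * b)          ≡⟨ *-assoc 8 b b ⟨
      8 * b * b            ∎)
    open SlidingMin.Correctness (suc n) (suc k) R L (8 * b) q b 1≤K K≤N z<s
           q-mono q-shift q-fibre q<8*b A using (solves; ℓ; S)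
    1≤ℓ : 1 ≤ ℓ
    1≤ℓ = ≤-trans (⌈log₂⌉-mono-≤ {2} {suc (suc n)} (s≤s (s≤s z≤n))) (m≤n+m _ ⌈log₂ suc R ⌉)
    S≤ : S ≤ 45 * ℓ * b
    S≤ = begin
      (3 + 8 * b + (b + b) * 2) * (1 + 2 * ℓ)          ≤⟨ *-mono-≤
                                                            (+-monoˡ-≤ ((b + b) * 2) (+-monoˡ-≤ (8 * b) (*-monoʳ-≤ 3 (s≤s (z≤n {r})))))
                                                            (+-monoˡ-≤ (2 * ℓ) 1≤ℓ) ⟩
      (3 * b + 8 * b + (b + b) * 2) * (ℓ + 2 * ℓ)      ≡⟨ solve 2 (λ x y →
                                                            (con 3 :* x :+ con 8 :* x :+ (x :+ x) :* con 2) :* (y :+ con 2 :* y) :=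
                                                            con 45 :* y :* x) refl b ℓ ⟩
      45 * ℓ * b                                       ∎
      where open +-*-Solver
    bound : ∀ {s} → s ≤ S → s ≤ 45 * ℓ ·√ suc n
    bound {s} s≤S = begin
      s * s                              ≤⟨ *-mono-≤ (≤-trans s≤S S≤) (≤-trans s≤S S≤) ⟩
      45 * ℓ * b * (45 * ℓ * b)          ≡⟨ [m*n]*[o*p]≡[m*o]*[n*p] (45 * ℓ) b (45 * ℓ) b ⟩
      45 * ℓ * (45 * ℓ) * (b * b)        ≤⟨ *-monoʳ-≤ (45 * ℓ * (45 * ℓ)) b*b≤N ⟩
      45 * ℓ * (45 * ℓ) * suc n          ∎
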